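{- 1. Let $\epsilon$ be a valuation, $\mathbf p$ an expectation lower bound (a function from valuations to $[0,1]$), $s$ a pGCL program, $l$ a logical variable, and $\varphi$ a pDL formula with no free logical variable other than possibly $l$. If $\epsilon\models[s]_{\mathbf p}\,(\forall l\cdot\varphi)$, then $\epsilon\models\forall l\cdot[s]_{\mathbf p}\,\varphi$. The converse fails in general: there exist a valuation $\epsilon$, an expectation lower bound $\mathbf p$, a pGCL program $s$, a logical variable $l$ (with some domain $\mathrm{dom}\,l$) and a pDL formula $\varphi$ with no free logical variable other than possibly $l$ such that $\epsilon\models\forall l\cdot[s]_{\mathbf p}\,\varphi$ but not $\epsilon\models[s]_{\mathbf p}\,(\forall l\cdot\varphi)$. 2. Let $\epsilon$ be a valuation, $\mathbf p$ an expectation lower bound (a function from valuations to $[0,1]$), $s$ a pGCL program, $l$ a logical variable, and $\varphi$ a pDL formula with no free logical variable other than possibly $l$. If $\epsilon\models\exists l\cdot[s]_{\mathbf p}\,\varphi$, then $\epsilon\models[s]_{\mathbf p}\,(\exists l\cdot\varphi)$. The converse fails in general: there exist a valuation $\epsilon$, an expectation lower bound $\mathbf p$, a pGCL program $s$, a logical variable $l$ (with some domain $\mathrm{dom}\,l$) and a pDL formula $\varphi$ with no free logical variable other than possibly $l$ such that $\epsilon\models[s]_{\mathbf p}\,(\exists l\cdot\varphi)$ but not $\epsilon\models\exists l\cdot[s]_{\mathbf p}\,\varphi$.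
   Context: **Programs (pGCL).** Fix a set $X$ of program variables. Expressions $e$ are built from program variables and primitive values (Booleans, numbers, ...) with the usual unary/binary arithmetic, comparison and logical operators; they are assumed well-formed, and $\epsilon(e)$ denotes the value of $e$ in a valuation $\epsilon$ (a map from program variables to values). Programs are $$s ::= s\sqcap s \mid s\,{}_{e}\!\oplus s\mid s;s\mid \mathtt{skip}\mid x:=e\mid \mathtt{if}\ e\ \{s\}\ \mathtt{else}\ \{s\}\mid\mathtt{while}\ e\ \{s\},$$ where $\sqcap$ is demonic (non-deterministic) choice and ${}_e\oplus$ is probabilistic choice (left branch with probability given by the value of $e$). **MDP semantics.** A program $s$ denotes a Markov decision process $\mathcal M_s$ with states $\langle\epsilon,s'\rangle$ (valuation, program). A positional policy $\pi$ maps states to available actions; the only states with more than one action are those where a demonic choice is to be resolved, and $\pi\langle\epsilon,s_1\sqcap s_2\rangle\in\{s_1,s_2\}$. For a policy $\pi$, the probabilistic transitions $\sigma\xrightarrow{p}_\pi\sigma'$ are given by the rules: - $\langle\epsilon,x:=e\rangle\xrightarrow{1}_\pi\langle\epsilon[x\mapsto\epsilon(e)],\mathtt{skip}\rangle$; - if $\epsilon(e)=p\in[0,1]$: $\langle\epsilon,s_1\,{}_e\!\oplus s_2\rangle\xrightarrow{p}_\pi\langle\epsilon,s_1\rangle$ and $\langle\epsilon,s_1\,{}_e\!\oplus s_2\rangle\xrightarrow{1-p}_\pi\langle\epsilon,s_2\rangle$ (probabilities are added if the targets coincide); - if $\pi\langle\epsilon,s_1\sqcap s_2\rangle=s_i$: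 $\langle\epsilon,s_1\sqcap s_2\rangle\xrightarrow{1}_\pi\langle\epsilon,s_i\rangle$; - if $\langle\epsilon,s_1\rangle\xrightarrow{p}_\pi\langle\epsilon',s_2\rangle$: $\langle\epsilon,\mathtt{skip};s_1\rangle\xrightarrow{p}_\pi\langle\epsilon',s_2\rangle$ and $\langle\epsilon,s_1;s\rangle\xrightarrow{p}_\pi\langle\epsilon',s_2;s\rangle$; - $\langle\epsilon,\mathtt{if}\ e\ \{s_1\}\ \mathtt{else}\ \{s_2\}\rangle\xrightarrow{1}_\pi\langle\epsilon,s_1\rangle$ if $\epsilon(e)=\mathit{true}$, and $\xrightarrow{1}_\pi\langle\epsilon,s_2\rangle$ if $\epsilon(e)=\mathit{false}$; - $\langle\epsilon,\mathtt{while}\ e\ \{s\}\rangle\xrightarrow{1}_\pi\langle\epsilon,s;\mathtt{while}\ e\ \{s\}\rangle$ if $\epsilon(e)=\mathit{true}$, and $\xrightarrow{1}_\pi\langle\epsilon,\mathtt{skip}\rangle$ if $\epsilon(e)=\mathit{false}$. A state is final if it has no transitions; the state $\langle\epsilon,\mathtt{skip}\rangle$ is final. Standing assumption: every program considered (every program occurring inside a box) reaches, from every initial valuation and under every policy, a state of the form $\langle\epsilon',\mathtt{skip}\rangle$ with probability $1$. **Expectations.** A path is a finite sequence of states $\sigma_1,\dots,\sigma_n$ with consecutive positive-probability transitions under $\pi$ ending in a final state $\mathrm{final}(\overline\sigma)=\sigma_n$; $\Pr(\overline\sigma)$ is the product of its transition probabilities (equal to $1$ for a one-state path), and $\mathrm{paths}_\pi(\sigma)$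 is the set of paths from $\sigma$. For a reward $r$ with values in $[0,1]$ on final states, $$\mathbb E_{\sigma,\pi}\,r=\sum_{\overline\sigma\in\mathrm{paths}_\pi(\sigma)}\Pr(\overline\sigma)\,r(\mathrm{final}(\overline\sigma)),\qquad \mathbf E_\sigma\,r=\inf_\pi\mathbb E_{\sigma,\pi}\,r .$$ A function of valuations is regarded as a reward by evaluating it on the valuation of the final state. **Logic (pDL).** Let $L$ be a set of logical variables disjoint from $X$; each $l\in L$ has a domain $\mathrm{dom}\,l$ of values. Formulae are $$\varphi::=\text{atomic formula}\mid\neg\varphi\mid\varphi_1\wedge\varphi_2\mid\forall l\cdot\varphi\mid[s]_{\mathbf p}\,\varphi,$$ where atomic formulae are built from constants, program variables and logical variables (they include equalities such as $x=l$ with $x\in X$, $l\in L$), $s$ is a pGCL program (it mentions no logical variables), and $\mathbf p$ is an expectation lower bound, i.e. a function from valuations of program variables to $[0,1]$ (not depending on logical variables, so $([s]_{\mathbf p}\varphi)[l:=v]$ is $[s]_{\mathbf p}(\varphi[l:=v])$). $\to,\vee,\exists$ are derived as usual ($\exists l\cdot\varphi$ is $\neg\forall l\cdot\neg\varphi$). Satisfaction $\epsilon\models\varphi$ for formulae without free logical variables is defined by: standard satisfaction for atomic formulae; the classical clauses for $\neg,\wedge$; $\epsilon\models\forall l\cdot\varphi$ iff $\epsilon\models\varphi[l:=v]$ for each $v\in\mathrm{dom}\,l$; and $$\epsilon\models[s]_{\mathbf p}\,\varphi\quad\text{iff}\quad \mathbf p(\epsilon)\le\mathbf E_{\langle\epsilon,s\rangle}[\![\varphi]\!]\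 \text{ in }\mathcal M_s,$$ where $[\![\varphi]\!](\epsilon')=1$ if $\epsilon'\models\varphi$ and $0$ otherwise. -}

module Defs where

open import Algebra.Structures using (IsCommutativeRing)
open import Axiom.ExcludedMiddle using (ExcludedMiddle)
open import Data.Bool.Base using (Bool; true; false; not; _∧_; _∨_)
open import Data.List.Base using (List; []; _∷_; map; foldr)
open import Data.List.Membership.Propositional using (_∈_)
open import Data.List.Relation.Unary.All using (All; []; _∷_; lookup)
open import Data.List.Relation.Unary.Unique.Propositional using (Unique)
open import Data.Product using (Σ; ∃; _×_; _,_; proj₁; proj₂)
open import Data.Sum using (_⊎_; [_,_])
open import Data.Unit.Base using (⊤)
open import Level using (0ℓ)
open import Relation.Binary.PropositionalEquality using (_≡_; _≢_; refl)
open import Relation.Binary.Structures using (IsTotalOrder)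
open import Relation.Nullary using (¬_; yes; no; does)

module _ {A : Set} (_≤_ : A → A → Set) where

  IsSup IsInf : {I : Set} → (I → A) → A → Set
  IsSup f u = (∀ i → f i ≤ u) × (∀ b → (∀ i → f i ≤ b) → u ≤ b)
  IsInf f u = (∀ i → u ≤ f i) × (∀ b → (∀ i → b ≤ f i) → b ≤ u)

-- The real numbers, through their characterisation (unique up to isomorphism)
-- as a Dedekind-complete ordered field.  The value of 0# ⁻¹ is unspecified.
record CompleteOrderedField : Set₁ where
  infix  8 -_ _⁻¹
  infixl 7 _*_
  infixl 6 _+_ _-_
  infix  4 _≤_ _<_
  field
    Carrier           : Set
    _+_ _*_           : Carrier → Carrier → Carrier
    -_ _⁻¹            : Carrier → Carrier
    0# 1#             : Carrier
    _≤_               : Carrier → Carrier → Set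
    isCommutativeRing : IsCommutativeRing _≡_ _+_ _*_ -_ 0# 1#
    *-inverseʳ        : ∀ {x} → x ≢ 0# → x * x ⁻¹ ≡ 1#
    isTotalOrder      : IsTotalOrder _≡_ _≤_
    0≤1               : 0# ≤ 1#
    0≢1               : 0# ≢ 1#
    +-monoˡ-≤         : ∀ {x y} z → x ≤ y → x + z ≤ y + z
    *-nonneg          : ∀ {x y} → 0# ≤ x → 0# ≤ y → 0# ≤ x * y
    complete          : ∀ {I : Set} (f : I → Carrier) → I →
                        (∃ λ b → ∀ i → f i ≤ b) → ∃ (IsSup _≤_ f)

  open IsTotalOrder isTotalOrder public using () renaming (refl to ≤-refl)

  _-_ : Carrier → Carrier → Carrier
  x - y = x + - y

  _<_ : Carrier → Carrier → Set
  x < y = x ≤ y × x ≢ y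

data Ty : Set where
  bool num : Ty

record ProgramVariables : Set₁ where
  field
    X    : Set
    type : X → Ty

module Values (R : CompleteOrderedField) where
  open CompleteOrderedField R public renaming (Carrier to ℝ)

  Val : Ty → Set
  Val bool = Bool
  Val num  = ℝ

  record LogicalVariables : Set₁ where
    field
      L     : Set
      ltype : L → Ty
      dom   : (l : L) → Val (ltype l) → Set

  record UnitInterval : Set where
    constructor unit
    field
      value : ℝ
      0≤    : 0# ≤ value
      ≤1    : value ≤ 1#

  open UnitInterval public

  infix  8 ⊖_ !_
  infixl 7 _⊗_ _⊘_
  infixl 6 _⊞_ _⊟_
  infix  5 _≐_ _≼_ _≺_
  infixr 4 _&&_
  infixr 3 _||_

  -- Intrinsically typed, so that every expression is well-formed.  V is the
  -- set of program variables for the expressions of programs, and also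
  -- contains logical variables for atomic formulae.
  data Expr (V : Set) (ty : V → Ty) : Ty → Set where
    var             : (x : V) → Expr V ty (ty x)
    const           : ∀ {τ} → Val τ → Expr V ty τ
    ⊖_              : Expr V ty num → Expr V ty num
    _⊞_ _⊟_ _⊗_ _⊘_ : Expr V ty num → Expr V ty num → Expr V ty num
    _≐_             : ∀ {τ} → Expr V ty τ → Expr V ty τ → Expr V ty bool
    _≼_ _≺_         : Expr V ty num → Expr V ty num → Expr V ty bool
    !_              : Expr V ty bool → Expr V ty bool
    _&&_ _||_       : Expr V ty bool → Expr V ty bool → Expr V ty bool

-- The semantics is classical: excluded middle decides comparisons of reals,
-- whether a formula holds (in 𝟙), and equality of program variables.
module pGCL (em : ExcludedMiddle 0ℓ) (R : CompleteOrderedField)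
            (PV : ProgramVariables) where
  open Values R public
  open ProgramVariables PV public

  -- A supremum (infimum) that does not exist is given the value 0#.
  sup inf : ∀ {I : Set} → (I → ℝ) → ℝ
  sup f with em {∃ (IsSup _≤_ f)}
  ... | yes (u , _) = u
  ... | no _        = 0#
  inf f with em {∃ (IsInf _≤_ f)}
  ... | yes (u , _) = u
  ... | no _        = 0#

  𝟙 : Set → UnitInterval
  𝟙 P with em {P}
  ... | yes _ = unit 1# 0≤1 ≤-refl
  ... | no _  = unit 0# ≤-refl 0≤1

  eval : ∀ {V ty τ} → ((x : V) → Val (ty x)) → Expr V ty τ → Val τ
  eval ε (var x)   = ε x
  eval ε (const v) = v
  eval ε (⊖ a)     = - eval ε a
  eval ε (a ⊞ b)   = eval ε a + eval ε b
  eval ε (a ⊟ b)   = eval ε a - eval ε b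
  eval ε (a ⊗ b)   = eval ε a * eval ε b
  eval ε (a ⊘ b)   = eval ε a * eval ε b ⁻¹
  eval ε (a ≐ b)   = does (em {eval ε a ≡ eval ε b})
  eval ε (a ≼ b)   = does (em {eval ε a ≤ eval ε b})
  eval ε (a ≺ b)   = does (em {eval ε a < eval ε b})
  eval ε (! a)     = not (eval ε a)
  eval ε (a && b)  = eval ε a ∧ eval ε b
  eval ε (a || b)  = eval ε a ∨ eval ε b

  Valuation : Set
  Valuation = (x : X) → Val (type x)

  _[_↦_] : Valuation → (x : X) → Val (type x) → Valuation
  (ε [ x ↦ v ]) y with em {x ≡ y}
  ... | yes refl = v
  ... | no _     = ε y

  Exp : Ty → Set
  Exp = Expr X type

  infix  6 _≔_
  infixr 4 _⨾_
  infixr 5 _⊓_ _⊕⟨_⟩_ IF_THEN_ELSE_ WHILE_DO_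

  data Program : Set where
    _⊓_              : Program → Program → Program
    _⊕⟨_⟩_           : Program → Exp num → Program → Program
    _⨾_              : Program → Program → Program
    skip             : Program
    _≔_              : (x : X) → Exp (type x) → Program
    IF_THEN_ELSE_ : Exp bool → Program → Program → Program
    WHILE_DO_      : Exp bool → Program → Program

  record State : Set where
    constructor ⟨_,_⟩
    field
      valuation : Valuation
      program   : Program

  open State public

  Action : State → Set
  Action ⟨ ε , s₁ ⊓ s₂ ⟩ = ∃ λ s → s ≡ s₁ ⊎ s ≡ s₂
  Action _               = ⊤

  Policy : Set
  Policy = (σ : State) → Action σ

  -- There is at most one p for given π, σ and σ′: coinciding targets of a
  -- probabilistic choice are covered by ⊕-same only.
  infix 3 _⊢_⟶[_]_
  data _⊢_⟶[_]_ (π : Policy) : State → ℝ → State → Set where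
    assign  : ∀ {ε x e} →
              π ⊢ ⟨ ε , x ≔ e ⟩ ⟶[ 1# ] ⟨ ε [ x ↦ eval ε e ] , skip ⟩
    ⊕-left  : ∀ {ε s₁ s₂ e} → 0# ≤ eval ε e → eval ε e ≤ 1# → s₁ ≢ s₂ →
              π ⊢ ⟨ ε , s₁ ⊕⟨ e ⟩ s₂ ⟩ ⟶[ eval ε e ] ⟨ ε , s₁ ⟩
    ⊕-right : ∀ {ε s₁ s₂ e} → 0# ≤ eval ε e → eval ε e ≤ 1# → s₁ ≢ s₂ →
              π ⊢ ⟨ ε , s₁ ⊕⟨ e ⟩ s₂ ⟩ ⟶[ 1# - eval ε e ] ⟨ ε , s₂ ⟩
    ⊕-same  : ∀ {ε s e} → 0# ≤ eval ε e → eval ε e ≤ 1# →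
              π ⊢ ⟨ ε , s ⊕⟨ e ⟩ s ⟩ ⟶[ eval ε e + (1# - eval ε e) ] ⟨ ε , s ⟩
    demonic : ∀ {ε s₁ s₂} →
              π ⊢ ⟨ ε , s₁ ⊓ s₂ ⟩ ⟶[ 1# ] ⟨ ε , proj₁ (π ⟨ ε , s₁ ⊓ s₂ ⟩) ⟩
    ⨾-skip  : ∀ {ε ε′ s₁ s₂ p} →
              π ⊢ ⟨ ε , s₁ ⟩ ⟶[ p ] ⟨ ε′ , s₂ ⟩ →
              π ⊢ ⟨ ε , skip ⨾ s₁ ⟩ ⟶[ p ] ⟨ ε′ , s₂ ⟩
    ⨾-left  : ∀ {ε ε′ s₁ s₂ s p} →
              π ⊢ ⟨ ε , s₁ ⟩ ⟶[ p ] ⟨ ε′ , s₂ ⟩ →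
              π ⊢ ⟨ ε , s₁ ⨾ s ⟩ ⟶[ p ] ⟨ ε′ , s₂ ⨾ s ⟩
    if-true     : ∀ {ε e s₁ s₂} → eval ε e ≡ true →
                  π ⊢ ⟨ ε , IF e THEN s₁ ELSE s₂ ⟩ ⟶[ 1# ] ⟨ ε , s₁ ⟩
    if-false    : ∀ {ε e s₁ s₂} → eval ε e ≡ false →
                  π ⊢ ⟨ ε , IF e THEN s₁ ELSE s₂ ⟩ ⟶[ 1# ] ⟨ ε , s₂ ⟩
    while-true  : ∀ {ε e s} → eval ε e ≡ true →
                  π ⊢ ⟨ ε , WHILE e DO s ⟩ ⟶[ 1# ]
                      ⟨ ε , s ⨾ WHILE e DO s ⟩
    while-false : ∀ {ε e s} → eval ε e ≡ false →
                  π ⊢ ⟨ ε , WHILE e DO s ⟩ ⟶[ 1# ] ⟨ ε , skip ⟩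

  Final : Policy → State → Set
  Final π σ = ∀ {p σ′} → ¬ (π ⊢ σ ⟶[ p ] σ′)

  data Path (π : Policy) (σ : State) : Set where
    stop : Final π σ → Path π σ
    step : ∀ {p σ′} → π ⊢ σ ⟶[ p ] σ′ → 0# < p → Path π σ′ → Path π σ

  module _ {π : Policy} where

    states : ∀ {σ} → Path π σ → List State
    states {σ} (stop _)     = σ ∷ []
    states {σ} (step _ _ ρ) = σ ∷ states ρ

    final : ∀ {σ} → Path π σ → State
    final {σ} (stop _)     = σ
    final     (step _ _ ρ) = final ρ

    Pr : ∀ {σ} → Path π σ → ℝ
    Pr (stop _)         = 1#
    Pr (step {p} _ _ ρ) = p * Pr ρ

  -- A finite set of paths.  Two paths are the same when their sequences of
  -- states are, whatever derivations of the transitions they carry.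
  FinitePathSet : Policy → State → Set
  FinitePathSet π σ = Σ (List (Path π σ)) λ ρs → Unique (map states ρs)

  Reward : Set
  Reward = State → UnitInterval

  -- The sum of a possibly infinite family of nonnegative terms is the supremum
  -- of its finite partial sums.
  𝔼 : Policy → State → Reward → ℝ
  𝔼 π σ r = sup λ (F : FinitePathSet π σ) →
    foldr (λ ρ t → Pr ρ * value (r (final ρ)) + t) 0# (proj₁ F)

  𝐄 : State → Reward → ℝ
  𝐄 σ r = inf λ (π : Policy) → 𝔼 π σ r

  AlmostSurelyTerminating : Program → Set
  AlmostSurelyTerminating s =
    ∀ ε π → 𝔼 π ⟨ ε , s ⟩ (λ σ → 𝟙 (program σ ≡ skip)) ≡ 1#

module pDL (em : ExcludedMiddle 0ℓ) (R : CompleteOrderedField)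
           (PV : ProgramVariables) (LV : Values.LogicalVariables R) where
  open pGCL em R PV public
  open LogicalVariables LV public

  LowerBound : Set
  LowerBound = Valuation → UnitInterval

  Atomic : List L → Set
  Atomic Γ = Expr (X ⊎ ∃ λ l → l ∈ Γ) [ type , (λ (l , _) → ltype l) ] bool

  infix  8 ~_
  infixr 7 _∧′_
  infixr 6 ∀′_∙_ ∃′_∙_ [_]⟨_⟩_

  -- Well-scoped: the free logical variables of a Formula Γ are among Γ.
  data Formula (Γ : List L) : Set where
    atom     : Atomic Γ → Formula Γ
    ~_       : Formula Γ → Formula Γ
    _∧′_     : Formula Γ → Formula Γ → Formula Γ
    ∀′_∙_    : (l : L) → Formula (l ∷ Γ) → Formula Γ
    [_]⟨_⟩_  : Program → LowerBound → Formula Γ → Formula Γ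

  ∃′_∙_ : ∀ {Γ} (l : L) → Formula (l ∷ Γ) → Formula Γ
  ∃′ l ∙ φ = ~ (∀′ l ∙ ~ φ)

  -- The values substituted for the free logical variables.
  Instantiation : List L → Set
  Instantiation = All (λ l → Val (ltype l))

  -- ε ⊨ φ [ θ ] is satisfaction of the closed instance of φ in which each free
  -- logical variable is replaced by its value in θ.
  infix 3 _⊨_[_] _⊨_
  _⊨_[_] : ∀ {Γ} → Valuation → Formula Γ → Instantiation Γ → Set
  ε ⊨ atom a [ θ ]         = eval [ ε , (λ (_ , l∈Γ) → lookup θ l∈Γ) ] a ≡ true
  ε ⊨ ~ φ [ θ ]            = ¬ (ε ⊨ φ [ θ ])
  ε ⊨ φ ∧′ ψ [ θ ]         = (ε ⊨ φ [ θ ]) × (ε ⊨ ψ [ θ ])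
  ε ⊨ ∀′ l ∙ φ [ θ ]       = ∀ v → dom l v → ε ⊨ φ [ v ∷ θ ]
  ε ⊨ [ s ]⟨ p ⟩ φ [ θ ]   =
    value (p ε) ≤ 𝐄 ⟨ ε , s ⟩ (λ σ → 𝟙 (valuation σ ⊨ φ [ θ ]))

  _⊨_ : Valuation → Formula [] → Set
  ε ⊨ φ = ε ⊨ φ [ [] ]

  Admissible : ∀ {Γ} → Formula Γ → Set
  Admissible (atom _)       = ⊤
  Admissible (~ φ)          = Admissible φ
  Admissible (φ ∧′ ψ)       = Admissible φ × Admissible ψ
  Admissible (∀′ _ ∙ φ)     = Admissible φ
  Admissible ([ s ]⟨ _ ⟩ φ) = AlmostSurelyTerminating s × Admissible φ

{-# OPTIONS --safe #-}
module Submission where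

-- Both implications are monotonicity of 𝐄 in the reward.  Because sup and
-- inf have a junk value where they do not exist, this needs the probabilities
-- of distinct paths from a state to sum to at most 1: a finite set of paths is
-- split by its first transition, by induction on a bound for their lengths.
-- Both converses fail for s = skip ⊕⟨ ½ ⟩ x ≔ b started with x = a ≠ b, and
-- with dom l everything: each x ≠ v has probability at least ½ but ∀ l. x ≠ l
-- has probability 0, and each x = v has probability at most ½ but ∃ l. x = l
-- has probability 1.

open import Defs
open import Algebra.Structures using (IsCommutativeRing)
open import Axiom.ExcludedMiddle using (ExcludedMiddle)
open import Data.Bool.Base using (true; false)
open import Data.Empty using (⊥-elim)
open import Data.List.Base using (List; []; _∷_; foldr; length; map)
open import Data.List.Extrema.Nat using (max; xs≤max)
open import Data.List.Membership.Propositional using (_∈_)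
open import Data.List.Relation.Unary.All as All using (All; []; _∷_)
import Data.List.Relation.Unary.All.Properties as All
open import Data.List.Relation.Unary.AllPairs using ([]; _∷_)
open import Data.List.Relation.Unary.Any using (here; there)
open import Data.List.Relation.Unary.Unique.Propositional using (Unique)
open import Data.Nat.Base as ℕ using (ℕ; zero; suc; pred)
import Data.Nat.Properties as ℕ
open import Data.Product using (∃; _×_; _,_; proj₁; proj₂)
open import Data.Sum using (_⊎_; inj₁; inj₂)
open import Data.Unit.Base using (⊤; tt)
open import Level using (0ℓ)
open import Relation.Binary.PropositionalEquality
  using (_≡_; _≢_; refl; sym; trans; cong; cong₂; subst; module ≡-Reasoning)
open import Relation.Binary.Structures using (IsTotalOrder)
open import Relation.Nullary using (Dec; ¬_; yes; no; does)
open import Relation.Nullary.Decidable using (dec-true)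

does-true : {P : Set} (d : Dec P) → does d ≡ true → P
does-true (yes p) _ = p

true≢false : true ≢ false
true≢false ()

-- Ordered-field arithmetic, the number one half, and infima.

module OrderedFieldProperties (R : CompleteOrderedField) where
  open CompleteOrderedField R
  open IsCommutativeRing isCommutativeRing public
    using (+-assoc; +-comm; +-identityˡ; +-identityʳ; -‿inverseʳ
          ; *-assoc; *-identityˡ; *-identityʳ; distribˡ; distribʳ
          ; zeroˡ; zeroʳ)
  open IsTotalOrder isTotalOrder public
    using () renaming (trans to ≤-trans; antisym to ≤-antisym
                      ; total to ≤-total; reflexive to ≤-reflexive)
  open ≡-Reasoning

  +-monoʳ-≤ : ∀ {x y} z → x ≤ y → z + x ≤ z + y
  +-monoʳ-≤ {x} {y} z x≤y
    rewrite +-comm z x | +-comm z y = +-monoˡ-≤ z x≤y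

  +-mono-≤ : ∀ {w x y z} → w ≤ x → y ≤ z → w + y ≤ x + z
  +-mono-≤ {x = x} {y = y} w≤x y≤z = ≤-trans (+-monoˡ-≤ y w≤x) (+-monoʳ-≤ x y≤z)

  x≤x+y : ∀ x {y} → 0# ≤ y → x ≤ x + y
  x≤x+y x {y} 0≤y = subst (_≤ x + y) (+-identityʳ x) (+-monoʳ-≤ x 0≤y)

  x+[y-x]≡y : ∀ x y → x + (y - x) ≡ y
  x+[y-x]≡y x y = begin
    x + (y - x)    ≡⟨ cong (x +_) (+-comm y (- x)) ⟩
    x + (- x + y)  ≡⟨ +-assoc x (- x) y ⟨
    x - x + y      ≡⟨ cong (_+ y) (-‿inverseʳ x) ⟩
    0# + y         ≡⟨ +-identityˡ y ⟩
    y              ∎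

  x≤y⇒0≤y-x : ∀ {x y} → x ≤ y → 0# ≤ y - x
  x≤y⇒0≤y-x {x} {y} x≤y = subst (_≤ y - x) (-‿inverseʳ x) (+-monoˡ-≤ (- x) x≤y)

  *-monoʳ-≤ : ∀ {x y z} → 0# ≤ z → x ≤ y → z * x ≤ z * y
  *-monoʳ-≤ {x} {y} {z} 0≤z x≤y = subst (z * x ≤_) (begin
    z * x + z * (y - x)  ≡⟨ distribˡ z x (y - x) ⟨
    z * (x + (y - x))    ≡⟨ cong (z *_) (x+[y-x]≡y x y) ⟩
    z * y                ∎)
    (x≤x+y (z * x) (*-nonneg 0≤z (x≤y⇒0≤y-x x≤y)))

  1≰0 : ¬ (1# ≤ 0#)
  1≰0 1≤0 = 0≢1 (≤-antisym 0≤1 1≤0)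

  ½ : Carrier
  ½ = (1# + 1#) ⁻¹

  ½+½≡1 : ½ + ½ ≡ 1#
  ½+½≡1 = begin
    ½ + ½              ≡⟨ cong₂ _+_ (*-identityˡ ½) (*-identityˡ ½) ⟨
    1# * ½ + 1# * ½    ≡⟨ distribʳ ½ 1# 1# ⟨
    (1# + 1#) * ½      ≡⟨ *-inverseʳ 2≢0 ⟩
    1#                 ∎
    where
    2≢0 : 1# + 1# ≢ 0#
    -- The value of `0# ⁻¹` is unspecified, so 1 + 1 = 0 has to be excluded: it would turn 1 ≤ 1 + 1
    -- into 1 ≤ 0.
    2≢0 2≡0 = 1≰0 (subst (1# ≤_) 2≡0 (x≤x+y 1# 0≤1))

  ½≰0 : ¬ (½ ≤ 0#)
  ½≰0 ½≤0 = 1≰0 (subst (_≤ 0#) ½+½≡1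
    (subst (½ + ½ ≤_) (+-identityˡ 0#) (+-mono-≤ ½≤0 ½≤0)))

  0≤½ : 0# ≤ ½
  0≤½ with ≤-total 0# ½
  ... | inj₁ 0≤½ = 0≤½
  ... | inj₂ ½≤0 = ⊥-elim (½≰0 ½≤0)

  0<½ : 0# < ½
  0<½ = 0≤½ , λ 0≡½ → ½≰0 (≤-reflexive (sym 0≡½))

  ½≤1 : ½ ≤ 1#
  ½≤1 = subst (½ ≤_) ½+½≡1 (x≤x+y ½ 0≤½)

  1-½≡½ : 1# - ½ ≡ ½
  1-½≡½ = begin
    1# - ½         ≡⟨ cong (_- ½) ½+½≡1 ⟨
    ½ + ½ - ½      ≡⟨ +-assoc ½ ½ (- ½) ⟩
    ½ + (½ - ½)    ≡⟨ cong (½ +_) (-‿inverseʳ ½) ⟩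
    ½ + 0#         ≡⟨ +-identityʳ ½ ⟩
    ½              ∎

  -- Subtracting ½ from both sides would leave ½ ≤ 0.
  1≰½ : ¬ (1# ≤ ½)
  1≰½ 1≤½ = ½≰0 (subst (_≤ 0#) 1-½≡½ (subst (1# - ½ ≤_) (-‿inverseʳ ½) (+-monoˡ-≤ (- ½) 1≤½)))

  -- The infimum is obtained as the supremum of all lower bounds. This family is inhabited by `b₀`
  -- and bounded above by `f i₀`, as `complete` requires.
  infimum : ∀ {I : Set} (f : I → Carrier) → I →
            (∃ λ b → ∀ i → b ≤ f i) → ∃ (IsInf _≤_ f)
  infimum f i₀ (b₀ , b₀≤f)
    with u , ub , least ← complete {∃ λ b → ∀ i → b ≤ f i} proj₁ (b₀ , b₀≤f)
                            (f i₀ , λ (_ , b≤f) → b≤f i₀)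
    = u , (λ i → least (f i) λ (_ , b≤f) → b≤f i) , λ b b≤f → ub (b , b≤f)

-- Expectations as genuine suprema and infima.

module Expectations (em : ExcludedMiddle 0ℓ) (R : CompleteOrderedField)
                    (PV : ProgramVariables) where
  open pGCL em R PV
  open OrderedFieldProperties R
  open ≡-Reasoning

  𝟙-true : ∀ {P} → P → value (𝟙 P) ≡ 1#
  𝟙-true {P} p with em {P}
  ... | yes _ = refl
  ... | no ¬p = ⊥-elim (¬p p)

  𝟙-false : ∀ {P} → ¬ P → value (𝟙 P) ≡ 0#
  𝟙-false {P} ¬p with em {P}
  ... | yes p = ⊥-elim (¬p p)
  ... | no _  = refl

  𝟙-mono : ∀ {P Q} → (P → Q) → value (𝟙 P) ≤ value (𝟙 Q)
  𝟙-mono {P} {Q} P⇒Q with em {P}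
  ... | yes p rewrite 𝟙-true (P⇒Q p) = ≤-refl
  ... | no _  = 0≤ (𝟙 Q)

  -- Once a supremum exists, `em` cannot have taken the branch with the default value 0.
  sup-isSup : ∀ {I : Set} {f : I → ℝ} → ∃ (IsSup _≤_ f) → IsSup _≤_ f (sup f)
  sup-isSup {f = f} s with em {∃ (IsSup _≤_ f)}
  ... | yes (_ , u) = u
  ... | no ¬s       = ⊥-elim (¬s s)

  inf-isInf : ∀ {I : Set} {f : I → ℝ} → ∃ (IsInf _≤_ f) → IsInf _≤_ f (inf f)
  inf-isInf {f = f} s with em {∃ (IsInf _≤_ f)}
  ... | yes (_ , u) = u
  ... | no ¬s       = ⊥-elim (¬s s)

  -- Shows that policies exist, so that the infimum over them ranges over an inhabited family. The
  -- case split makes `Action` reduce.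
  policy : Policy
  policy ⟨ _ , s ⊓ _ ⟩               = s , inj₁ refl
  policy ⟨ _ , _ ⊕⟨ _ ⟩ _ ⟩          = tt
  policy ⟨ _ , _ ⨾ _ ⟩               = tt
  policy ⟨ _ , skip ⟩                = tt
  policy ⟨ _ , _ ≔ _ ⟩               = tt
  policy ⟨ _ , IF _ THEN _ ELSE _ ⟩  = tt
  policy ⟨ _ , WHILE _ DO _ ⟩        = tt

  -- At most two successors for each state.

  Cover : Policy → State → ℝ → State → ℝ → State → Set
  Cover π σ p₁ σ₁ p₂ σ₂ = ∀ {p σ′} → π ⊢ σ ⟶[ p ] σ′ →
    (p ≡ p₁ × σ′ ≡ σ₁) ⊎ (p ≡ p₂ × σ′ ≡ σ₂)

  -- Two successors always suffice; a state with fewer gets a spurious second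
  -- one of probability 0, and a stuck state is covered by anything.
  record Branching (π : Policy) (σ : State) : Set where
    field
      {p₁ p₂} : ℝ
      {σ₁ σ₂} : State
      0≤p₁    : 0# ≤ p₁
      0≤p₂    : 0# ≤ p₂
      p₁+p₂≤1 : p₁ + p₂ ≤ 1#
      cover   : Cover π σ p₁ σ₁ p₂ σ₂

  deterministic : ∀ {π σ σ₁} → (∀ {p σ′} → π ⊢ σ ⟶[ p ] σ′ → p ≡ 1# × σ′ ≡ σ₁) →
                  Branching π σ
  deterministic {σ₁ = σ₁} f = record
    -- The proofs `0≤1` and `≤-refl` fix the two probabilities as 1 and 0 by unification.
    { σ₂ = σ₁ ; 0≤p₁ = 0≤1 ; 0≤p₂ = ≤-refl ; p₁+p₂≤1 = ≤-reflexive (+-identityʳ 1#)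
    ; cover = λ t → inj₁ (f t) }

  stuck : ∀ {π σ} → Final π σ → Branching π σ
  stuck {σ = σ} f = deterministic {σ₁ = σ} λ t → ⊥-elim (f t)

  skip-final : ∀ {π ε} → Final π ⟨ ε , skip ⟩
  skip-final ()

  skip? : ∀ s → s ≡ skip ⊎ s ≢ skip
  skip? s with em {s ≡ skip}
  ... | yes eq = inj₁ eq
  ... | no neq = inj₂ neq

  ⊕-cover : ∀ {π ε s₁ s₂ e} → s₁ ≢ s₂ →
            Cover π ⟨ ε , s₁ ⊕⟨ e ⟩ s₂ ⟩
                  (eval ε e) ⟨ ε , s₁ ⟩ (1# - eval ε e) ⟨ ε , s₂ ⟩
  ⊕-cover _  (⊕-left _ _ _)  = inj₁ (refl , refl)
  ⊕-cover _  (⊕-right _ _ _) = inj₂ (refl , refl)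
  ⊕-cover ≢s (⊕-same _ _)    = ⊥-elim (≢s refl)

  -- By recursion on the program. Sequencing inherits the successors of the component that moves,
  -- with the remainder appended when that is the first one.
  branching : ∀ π ε s → Branching π ⟨ ε , s ⟩
  branching π ε (s₁ ⊓ s₂) = deterministic λ where demonic → refl , refl
  branching π ε (s₁ ⊕⟨ e ⟩ s₂)
    with em {0# ≤ eval ε e} | em {eval ε e ≤ 1#} | em {s₁ ≡ s₂}
  -- A parameter outside the unit interval enables no rule.
  ... | no ≰  | _      | _  = stuck λ where
    (⊕-left q _ _)  → ≰ q
    (⊕-right q _ _) → ≰ q
    (⊕-same q _)    → ≰ q
  ... | yes _ | no ≰   | _  = stuck λ where
    (⊕-left _ q _)  → ≰ q
    (⊕-right _ q _) → ≰ q
    (⊕-same _ q)    → ≰ q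
  -- Coinciding branches have a single transition, of probability e + (1 - e) = 1.
  ... | yes _ | yes _  | yes refl = deterministic λ where
    (⊕-left _ _ ≢s)  → ⊥-elim (≢s refl)
    (⊕-right _ _ ≢s) → ⊥-elim (≢s refl)
    (⊕-same _ _)     → x+[y-x]≡y (eval ε e) 1# , refl
  ... | yes 0≤e | yes e≤1 | no ≢s = record
    { 0≤p₁ = 0≤e ; 0≤p₂ = x≤y⇒0≤y-x e≤1
    ; p₁+p₂≤1 = ≤-reflexive (x+[y-x]≡y (eval ε e) 1#)
    ; cover = ⊕-cover ≢s }
  -- Since `skip` itself cannot move, `⨾-skip` and `⨾-left` never apply to the same state.
  branching π ε (s₁ ⨾ s) with skip? s₁
  ... | inj₁ refl = record
    { 0≤p₁ = 0≤p₁ ; 0≤p₂ = 0≤p₂ ; p₁+p₂≤1 = p₁+p₂≤1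
    ; cover = λ where
        (⨾-skip t) → cover t
        (⨾-left ()) }
    where open Branching (branching π ε s)
  ... | inj₂ ≢skip = record
    { 0≤p₁ = 0≤p₁ ; 0≤p₂ = 0≤p₂ ; p₁+p₂≤1 = p₁+p₂≤1
    ; cover = cover-⨾ }
    where
    open Branching (branching π ε s₁)
    cover-⨾ : Cover π ⟨ ε , s₁ ⨾ s ⟩ p₁ ⟨ valuation σ₁ , program σ₁ ⨾ s ⟩
                                     p₂ ⟨ valuation σ₂ , program σ₂ ⨾ s ⟩
    cover-⨾ (⨾-skip _) = ⊥-elim (≢skip refl)
    cover-⨾ (⨾-left t) with cover t
    ... | inj₁ (refl , refl) = inj₁ (refl , refl)
    ... | inj₂ (refl , refl) = inj₂ (refl , refl)
  branching π ε skip = stuck skip-final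
  branching π ε (x ≔ e) = deterministic λ where assign → refl , refl
  branching π ε (IF e THEN s₁ ELSE s₂) with eval ε e in eq
  ... | true  = deterministic λ where
    (if-true _)    → refl , refl
    (if-false eq′) → ⊥-elim (true≢false (trans (sym eq) eq′))
  ... | false = deterministic λ where
    (if-false _)  → refl , refl
    (if-true eq′) → ⊥-elim (true≢false (trans (sym eq′) eq))
  branching π ε (WHILE e DO s) with eval ε e in eq
  ... | true  = deterministic λ where
    (while-true _)    → refl , refl
    (while-false eq′) → ⊥-elim (true≢false (trans (sym eq) eq′))
  ... | false = deterministic λ where
    (while-false _)  → refl , refl
    (while-true eq′) → ⊥-elim (true≢false (trans (sym eq′) eq))

  -- Sums over finite sets of paths, by their first transition.

  module _ {π : Policy} where

    weight : ∀ {σ} → Reward → Path π σ → ℝ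
    weight r ρ = Pr ρ * value (r (final ρ))

    -- Agrees definitionally with the partial sums inside `𝔼`.
    total : ∀ {σ} → Reward → List (Path π σ) → ℝ
    total r = foldr (λ ρ t → weight r ρ + t) 0#

    Pr-nonneg : ∀ {σ} (ρ : Path π σ) → 0# ≤ Pr ρ
    Pr-nonneg (stop _)             = 0≤1
    Pr-nonneg (step _ (0≤p , _) ρ) = *-nonneg 0≤p (Pr-nonneg ρ)

    total-mono : ∀ {σ} r r′ → (∀ σ′ → value (r σ′) ≤ value (r′ σ′)) →
                 (ρs : List (Path π σ)) → total r ρs ≤ total r′ ρs
    total-mono r r′ r≤r′ []       = ≤-refl
    total-mono r r′ r≤r′ (ρ ∷ ρs) =
      +-mono-≤ (*-monoʳ-≤ (Pr-nonneg ρ) (r≤r′ (final ρ))) (total-mono r r′ r≤r′ ρs)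

    -- The fields `tails₁` and `tails₂` carry both properties needed of the tails back to the
    -- original list: distinctness of state sequences and the bound on their lengths.
    record Split {σ} (r : Reward) (p₁ : ℝ) (σ₁ : State) (p₂ : ℝ) (σ₂ : State)
                 (ρs : List (Path π σ)) : Set where
      field
        ρs₁     : List (Path π σ₁)
        ρs₂     : List (Path π σ₂)
        unique₁ : Unique (map states ρs₁)
        unique₂ : Unique (map states ρs₂)
        tails₁  : ∀ {xs} → xs ∈ map states ρs₁ → σ ∷ xs ∈ map states ρs
        tails₂  : ∀ {xs} → xs ∈ map states ρs₂ → σ ∷ xs ∈ map states ρs
        total≡  : total r ρs ≡ p₁ * total r ρs₁ + p₂ * total r ρs₂

    split : ∀ {σ r p₁ σ₁ p₂ σ₂} → ¬ Final π σ → Cover π σ p₁ σ₁ p₂ σ₂ →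
            (ρs : List (Path π σ)) → Unique (map states ρs) →
            Split r p₁ σ₁ p₂ σ₂ ρs
    split {p₁ = p₁} {p₂ = p₂} ¬f c [] _ = record
      { ρs₁ = [] ; ρs₂ = [] ; unique₁ = [] ; unique₂ = []
      ; tails₁ = λ () ; tails₂ = λ ()
      ; total≡ = sym (trans (cong₂ _+_ (zeroʳ p₁) (zeroʳ p₂)) (+-identityˡ 0#)) }
    -- A one-state path has no first transition to split on, but it exists only at a final state.
    split ¬f c (stop f ∷ ρs) _ = ⊥-elim (¬f f)
    split {σ} {r} {p₁} {σ₁} {p₂} {σ₂} ¬f c (step t _ τ ∷ ρs) (u ∷ us)
      with c t | split {r = r} ¬f c ρs us
    ... | inj₁ (refl , refl) | S = record
      { ρs₁ = τ ∷ ρs₁ ; ρs₂ = ρs₂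
      -- If the new tail already occurred, prefixing σ would make the head path occur again among
      -- `ρs`.
      ; unique₁ = All.tabulate (λ xs∈ eq → All.lookup u (tails₁ xs∈) (cong (σ ∷_) eq)) ∷ unique₁
      ; unique₂ = unique₂
      ; tails₁ = λ { (here eq) → here (cong (σ ∷_) eq) ; (there xs∈) → there (tails₁ xs∈) }
      ; tails₂ = λ xs∈ → there (tails₂ xs∈)
      ; total≡ = begin
          p₁ * Pr τ * w + total r ρs
            ≡⟨ cong₂ _+_ (*-assoc p₁ (Pr τ) w) total≡ ⟩
          p₁ * (Pr τ * w) + (p₁ * total r ρs₁ + p₂ * total r ρs₂)
            ≡⟨ +-assoc _ _ _ ⟨
          p₁ * (Pr τ * w) + p₁ * total r ρs₁ + p₂ * total r ρs₂
            ≡⟨ cong (_+ p₂ * total r ρs₂) (distribˡ p₁ _ _) ⟨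
          p₁ * (Pr τ * w + total r ρs₁) + p₂ * total r ρs₂
            ∎ }
      where
      open Split S
      w = value (r (final τ))
    ... | inj₂ (refl , refl) | S = record
      { ρs₁ = ρs₁ ; ρs₂ = τ ∷ ρs₂
      ; unique₁ = unique₁
      ; unique₂ = All.tabulate (λ xs∈ eq → All.lookup u (tails₂ xs∈) (cong (σ ∷_) eq)) ∷ unique₂
      ; tails₁ = λ xs∈ → there (tails₁ xs∈)
      ; tails₂ = λ { (here eq) → here (cong (σ ∷_) eq) ; (there xs∈) → there (tails₂ xs∈) }
      ; total≡ = begin
          p₂ * Pr τ * w + total r ρs
            ≡⟨ cong₂ _+_ (*-assoc p₂ (Pr τ) w) (trans total≡ (+-comm _ _)) ⟩
          p₂ * (Pr τ * w) + (p₂ * total r ρs₂ + p₁ * total r ρs₁)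
            ≡⟨ +-assoc _ _ _ ⟨
          p₂ * (Pr τ * w) + p₂ * total r ρs₂ + p₁ * total r ρs₁
            ≡⟨ cong (_+ p₁ * total r ρs₁) (distribˡ p₂ _ _) ⟨
          p₂ * (Pr τ * w + total r ρs₂) + p₁ * total r ρs₁
            ≡⟨ +-comm _ _ ⟩
          p₁ * total r ρs₁ + p₂ * (Pr τ * w + total r ρs₂)
            ∎ }
      where
      open Split S
      w = value (r (final τ))

    -- The length cap is the parameter of the induction; `length` counts states, so every path has
    -- length at least 1.
    BoundedUpTo : ℕ → Reward → State → ℝ → Set
    BoundedUpTo n r σ c = (ρs : List (Path π σ)) → Unique (map states ρs) →
      All (λ xs → length xs ℕ.≤ n) (map states ρs) → total r ρs ≤ c

    -- A final state has just one state sequence, and uniqueness allows it at most once.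
    final-bounded : ∀ {n} r {σ} → Final π σ → BoundedUpTo n r σ (value (r σ))
    final-bounded r {σ} f [] _ _ = 0≤ (r σ)
    final-bounded r {σ} f (stop _ ∷ []) _ _ =
      ≤-reflexive (trans (+-identityʳ _) (*-identityˡ _))
    final-bounded r f (step t _ _ ∷ _) _ _ = ⊥-elim (f t)
    final-bounded r f (stop _ ∷ stop _ ∷ _) ((≢σ ∷ _) ∷ _) _ = ⊥-elim (≢σ refl)
    final-bounded r f (stop _ ∷ step t _ _ ∷ _) _ _ = ⊥-elim (f t)

    -- Dropping the first state shortens every sequence by one, and `total` is the weighted sum of
    -- the totals of the tails. Using `pred` lets the cap n be arbitrary.
    step-bounded : ∀ {n} r {σ p₁ σ₁ p₂ σ₂ c₁ c₂} → ¬ Final π σ →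
      Cover π σ p₁ σ₁ p₂ σ₂ → 0# ≤ p₁ → 0# ≤ p₂ →
      BoundedUpTo (pred n) r σ₁ c₁ → BoundedUpTo (pred n) r σ₂ c₂ →
      BoundedUpTo n r σ (p₁ * c₁ + p₂ * c₂)
    step-bounded r {p₁ = p₁} {p₂ = p₂} {c₁ = c₁} {c₂} ¬f c 0≤p₁ 0≤p₂ b₁ b₂ ρs u ≤n =
      subst (_≤ p₁ * c₁ + p₂ * c₂) (sym total≡) (+-mono-≤
        (*-monoʳ-≤ 0≤p₁ (b₁ ρs₁ unique₁
          (All.tabulate λ xs∈ → ℕ.pred-mono-≤ (All.lookup ≤n (tails₁ xs∈)))))
        (*-monoʳ-≤ 0≤p₂ (b₂ ρs₂ unique₂
          (All.tabulate λ xs∈ → ℕ.pred-mono-≤ (All.lookup ≤n (tails₂ xs∈))))))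
      where open Split (split {r = r} ¬f c ρs u)

    -- Induction on the cap: the paths through each successor contribute at most 1 before weighting,
    -- and the two weights add up to at most 1. With cap 0 only the empty set is left.
    1-bounded : ∀ n r σ → BoundedUpTo n r σ 1#
    1-bounded zero r σ [] _ _ = 0≤1
    1-bounded zero r σ (stop _ ∷ _) _ (() ∷ _)
    1-bounded zero r σ (step _ _ _ ∷ _) _ (() ∷ _)
    1-bounded (suc n) r σ ρs u ≤n with em {∀ {p σ′} → ¬ (π ⊢ σ ⟶[ p ] σ′)}
    ... | yes f = ≤-trans (final-bounded r f ρs u ≤n) (≤1 (r σ))
    ... | no ¬f = ≤-trans
      (step-bounded r ¬f cover 0≤p₁ 0≤p₂ (1-bounded n r σ₁) (1-bounded n r σ₂) ρs u ≤n)
      (subst (_≤ 1#) (sym (cong₂ _+_ (*-identityʳ p₁) (*-identityʳ p₂))) p₁+p₂≤1)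
      where open Branching (branching π (valuation σ) (program σ))

    Bounded : Reward → State → ℝ → Set
    Bounded r σ c = (F : FinitePathSet π σ) → total r (proj₁ F) ≤ c

    bounded : ∀ r {σ c} → (∀ n → BoundedUpTo n r σ c) → Bounded r σ c
    -- A finite set has a longest path, whose length serves as the cap; the 0 is for the empty set.
    bounded r b (ρs , u) = b (max 0 (map length (map states ρs))) ρs u
      (All.map⁻ (xs≤max 0 (map length (map states ρs))))

    -- The empty path set makes the family inhabited and 1 bounds it, so `𝔼` is never the default
    -- value of `sup`.
    𝔼-isSup : ∀ σ r → IsSup _≤_ (λ (F : FinitePathSet π σ) → total r (proj₁ F)) (𝔼 π σ r)
    𝔼-isSup σ r = sup-isSup
      (complete _ ([] , []) (1# , bounded r λ n → 1-bounded n r σ))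

    𝔼-nonneg : ∀ σ r → 0# ≤ 𝔼 π σ r
    𝔼-nonneg σ r = proj₁ (𝔼-isSup σ r) ([] , [])

    -- Each partial sum for r is at most the one for r′ over the same paths, hence at most the
    -- supremum for r′.
    𝔼-mono : ∀ {σ} r r′ → (∀ σ′ → value (r σ′) ≤ value (r′ σ′)) → 𝔼 π σ r ≤ 𝔼 π σ r′
    𝔼-mono {σ} r r′ r≤r′ = proj₂ (𝔼-isSup σ r) _ λ (ρs , u) →
      ≤-trans (total-mono r r′ r≤r′ ρs) (proj₁ (𝔼-isSup σ r′) (ρs , u))

  𝐄-isInf : ∀ σ r → IsInf _≤_ (λ π → 𝔼 π σ r) (𝐄 σ r)
  𝐄-isInf σ r = inf-isInf (infimum _ policy (0# , λ π → 𝔼-nonneg σ r))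

  𝐄-mono : ∀ {σ} r r′ → (∀ σ′ → value (r σ′) ≤ value (r′ σ′)) → 𝐄 σ r ≤ 𝐄 σ r′
  𝐄-mono {σ} r r′ r≤r′ = proj₂ (𝐄-isInf σ r′) _ λ π →
    ≤-trans (proj₁ (𝐄-isInf σ r) π) (𝔼-mono r r′ r≤r′)

  -- A fair coin program and its exact expectation.

  low high : ∀ τ → Val τ
  low  bool = false
  low  num  = 0#
  high bool = true
  high num  = 1#

  -- Two distinct values in either type, so that the variable x may be Boolean or numeric.
  low≢high : ∀ τ → low τ ≢ high τ
  low≢high bool ()
  low≢high num  = 0≢1

  [↦]-same : ∀ ε x v → (ε [ x ↦ v ]) x ≡ v
  [↦]-same ε x v with em {x ≡ x}
  ... | yes refl = refl
  ... | no x≢x   = ⊥-elim (x≢x refl)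

  module Coin (x : X) where

    coin : Program
    coin = skip ⊕⟨ const ½ ⟩ x ≔ const (high (type x))

    module _ (ε : Valuation) (r : Reward) where

      heads tails : State
      heads = ⟨ ε , skip ⟩
      tails = ⟨ ε [ x ↦ high (type x) ] , skip ⟩

      average : ℝ
      average = ½ * value (r heads) + ½ * value (r tails)

      module _ {π : Policy} where

        toHeads : π ⊢ ⟨ ε , coin ⟩ ⟶[ ½ ] ⟨ ε , skip ⟩
        toHeads = ⊕-left 0≤½ ½≤1 λ ()

        toTails : π ⊢ ⟨ ε , coin ⟩ ⟶[ 1# - ½ ] ⟨ ε , x ≔ const (high (type x)) ⟩
        toTails = ⊕-right 0≤½ ½≤1 λ ()

        assign-bounded : ∀ n → BoundedUpTo {π} n r ⟨ ε , x ≔ const (high (type x)) ⟩ (value (r tails))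
        assign-bounded n ρs u ≤n = subst (total r ρs ≤_)
          (trans (cong₂ _+_ (*-identityˡ _) (zeroˡ _)) (+-identityʳ _))
          -- An assignment has one successor; the second one is a dummy, again `tails`, with weight
          -- 0.
          (step-bounded {n = n} r (λ f → f assign) (λ { assign → inj₁ (refl , refl) })
            0≤1 ≤-refl
            (final-bounded {n = pred n} r skip-final)
            (final-bounded {n = pred n} r {σ = tails} skip-final) ρs u ≤n)

        coin-bounded : ∀ n → BoundedUpTo {π} n r ⟨ ε , coin ⟩ average
        coin-bounded n ρs u ≤n = subst (total r ρs ≤_)
          (cong (λ h → ½ * value (r heads) + h * value (r tails)) 1-½≡½)
          (step-bounded {n = n} r (λ f → f toHeads) (⊕-cover λ ())
            0≤½ (x≤y⇒0≤y-x ½≤1)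
            (final-bounded {n = pred n} r skip-final) (assign-bounded (pred n)) ρs u ≤n)

        outcomes : FinitePathSet π ⟨ ε , coin ⟩
        outcomes =
            step toHeads 0<½ (stop skip-final)
          ∷ step toTails (subst (0# <_) (sym 1-½≡½) 0<½) (step assign (0≤1 , 0≢1) (stop skip-final))
          ∷ []
          -- The two runs visit two and three states, so their sequences differ.
          , ((λ ()) ∷ []) ∷ [] ∷ []

        total-outcomes : total r (proj₁ outcomes) ≡ average
        total-outcomes = cong₂ _+_
          (cong (_* value (r heads)) (*-identityʳ ½))
          (trans (+-identityʳ _) (cong (_* value (r tails)) (begin
            (1# - ½) * (1# * 1#)  ≡⟨ cong₂ _*_ 1-½≡½ (*-identityˡ 1#) ⟩
            ½ * 1#                ≡⟨ *-identityʳ ½ ⟩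
            ½                     ∎)))

        -- `coin-bounded` limits every partial sum by the average, and the set `outcomes` attains
        -- it.
        𝔼-coin : 𝔼 π ⟨ ε , coin ⟩ r ≡ average
        𝔼-coin = ≤-antisym
          (proj₂ (𝔼-isSup _ r) average (bounded r coin-bounded))
          (subst (_≤ 𝔼 π ⟨ ε , coin ⟩ r) total-outcomes (proj₁ (𝔼-isSup _ r) outcomes))

      -- The program has no demonic choice, so the infimum is over a constant family; `policy`
      -- supplies a member.
      𝐄-coin : 𝐄 ⟨ ε , coin ⟩ r ≡ average
      𝐄-coin = ≤-antisym
        (subst (𝐄 ⟨ ε , coin ⟩ r ≤_) 𝔼-coin (proj₁ (𝐄-isInf _ r) policy))
        (proj₂ (𝐄-isInf _ r) average λ π → ≤-reflexive (sym 𝔼-coin))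

      average-11 : value (r heads) ≡ 1# → value (r tails) ≡ 1# → average ≡ 1#
      average-11 h t = trans
        (cong₂ _+_ (trans (cong (½ *_) h) (*-identityʳ ½)) (trans (cong (½ *_) t) (*-identityʳ ½)))
        ½+½≡1

      average-00 : value (r heads) ≡ 0# → value (r tails) ≡ 0# → average ≡ 0#
      average-00 h t = trans
        (cong₂ _+_ (trans (cong (½ *_) h) (zeroʳ ½)) (trans (cong (½ *_) t) (zeroʳ ½)))
        (+-identityˡ 0#)

      -- The branch with reward 1 contributes ½ alone, and the other one is nonnegative.
      average-≥½ : value (r heads) ≡ 1# ⊎ value (r tails) ≡ 1# → ½ ≤ average
      average-≥½ (inj₁ h) = subst (_≤ average) (trans (cong (½ *_) h) (*-identityʳ ½))
        (x≤x+y _ (*-nonneg 0≤½ (0≤ (r tails))))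
      average-≥½ (inj₂ t) = subst (_≤ average) (trans (cong (½ *_) t) (*-identityʳ ½))
        (subst (½ * value (r tails) ≤_) (+-comm _ _) (x≤x+y _ (*-nonneg 0≤½ (0≤ (r heads)))))

      -- The branch with reward 0 contributes nothing, and the other one at most ½.
      average-≤½ : value (r heads) ≡ 0# ⊎ value (r tails) ≡ 0# → average ≤ ½
      average-≤½ (inj₁ h) = subst (average ≤_)
        (trans (cong₂ _+_ (zeroʳ ½) (*-identityʳ ½)) (+-identityˡ ½))
        (+-mono-≤ (*-monoʳ-≤ 0≤½ (≤-reflexive h)) (*-monoʳ-≤ 0≤½ (≤1 (r tails))))
      average-≤½ (inj₂ t) = subst (average ≤_)
        (trans (cong₂ _+_ (*-identityʳ ½) (zeroʳ ½)) (+-identityʳ ½))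
        (+-mono-≤ (*-monoʳ-≤ 0≤½ (≤1 (r heads))) (*-monoʳ-≤ 0≤½ (≤-reflexive t)))

    coin-terminates : AlmostSurelyTerminating coin
    coin-terminates ε π = trans (𝔼-coin ε r) (average-11 ε r (𝟙-true refl) (𝟙-true refl))
      where
      r : Reward
      r σ = 𝟙 (program σ ≡ skip)

-- The two implications.

module Quantifiers (em : ExcludedMiddle 0ℓ) (R : CompleteOrderedField)
                   (PV : ProgramVariables) (LV : Values.LogicalVariables R) where
  open pDL em R PV LV
  open OrderedFieldProperties R using (≤-trans)
  open Expectations em R PV

  -- Implication between postconditions orders their indicator rewards pointwise. The contexts may
  -- differ, so that a quantified formula can be compared with an instance of its body.
  box-mono : ∀ {Γ Δ ε p s} {φ : Formula Γ} {ψ : Formula Δ} {θ θ′} →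
             (∀ ε′ → ε′ ⊨ φ [ θ ] → ε′ ⊨ ψ [ θ′ ]) →
             ε ⊨ [ s ]⟨ p ⟩ φ [ θ ] → ε ⊨ [ s ]⟨ p ⟩ ψ [ θ′ ]
  box-mono {φ = φ} {ψ} {θ} {θ′} φ⇒ψ h = ≤-trans h
    (𝐄-mono (λ σ → 𝟙 (valuation σ ⊨ φ [ θ ])) (λ σ → 𝟙 (valuation σ ⊨ ψ [ θ′ ]))
            (λ σ → 𝟙-mono (φ⇒ψ (valuation σ))))

  box-∀ : ∀ {ε p s l} {φ : Formula (l ∷ [])} →
          ε ⊨ [ s ]⟨ p ⟩ (∀′ l ∙ φ) → ε ⊨ ∀′ l ∙ [ s ]⟨ p ⟩ φ
  box-∀ {p = p} {s} {l} {φ} h v d =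
    box-mono {p = p} {s} {∀′ l ∙ φ} {φ} (λ _ ∀φ → ∀φ v d) h

  ∃-box : ∀ {ε p s l} {φ : Formula (l ∷ [])} →
          ε ⊨ ∃′ l ∙ [ s ]⟨ p ⟩ φ → ε ⊨ [ s ]⟨ p ⟩ (∃′ l ∙ φ)
  -- `∃′` is a negated universal and yields no witness, so the argument is by contradiction: if the
  -- conclusion fails, then the box fails for every v, against h.
  ∃-box {ε} {p} {s} {l} {φ} h with em {ε ⊨ [ s ]⟨ p ⟩ (∃′ l ∙ φ)}
  ... | yes b = b
  ... | no ¬b = ⊥-elim (h λ v d b →
    ¬b (box-mono {p = p} {s} {φ} {∃′ l ∙ φ} (λ _ φv ∀¬φ → ∀¬φ v d φv) b))

-- Failure of the two converses.

module Counterexamples (em : ExcludedMiddle 0ℓ) (R : CompleteOrderedField)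
                       (PV : ProgramVariables) (x : ProgramVariables.X PV) where
  open ProgramVariables PV using (type)

  -- A single logical variable of the type of x, with full domain, so that the current value of x is
  -- always an admissible instance.
  LV : Values.LogicalVariables R
  LV = record { L = ⊤ ; ltype = λ _ → type x ; dom = λ _ _ → ⊤ }

  open pDL em R PV LV hiding (type)
  open OrderedFieldProperties R
  open Expectations em R PV
  open Coin x

  ε₀ : Valuation
  ε₀ y = low (type y)

  x≐l : Formula (tt ∷ [])
  x≐l = atom (var (inj₁ x) ≐ var (inj₂ (tt , here refl)))

  x≢l : Formula (tt ∷ [])
  x≢l = ~ x≐l

  x≐l⇒ : ∀ {ε v} → ε ⊨ x≐l [ v ∷ [] ] → ε x ≡ v
  x≐l⇒ = does-true em

  ⇒x≐l : ∀ {ε v} → ε x ≡ v → ε ⊨ x≐l [ v ∷ [] ]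
  ⇒x≐l = dec-true em

  ε₁ : Valuation
  ε₁ = ε₀ [ x ↦ high (type x) ]

  -- The variable is low in one outcome and high in the other, so no v matches both.
  x-differs : ∀ v → ε₀ x ≢ v ⊎ ε₁ x ≢ v
  x-differs v with em {ε₀ x ≡ v}
  ... | no ≢v    = inj₁ ≢v
  ... | yes refl = inj₂ λ eq →
    low≢high (type x) (trans (sym eq) ([↦]-same ε₀ x (high (type x))))

  -- Each threshold lies between the two probabilities it separates: 0 < ½ ≤ ½ for the universal
  -- case and ½ < 1 ≤ 1 for the existential one.
  p½ p1 : LowerBound
  p½ _ = unit ½ 0≤½ ½≤1
  p1 _ = unit 1# 0≤1 ≤-refl

  ⟦_⟧ : Formula (tt ∷ []) → Val (type x) → Reward
  ⟦ φ ⟧ v σ = 𝟙 (valuation σ ⊨ φ [ v ∷ [] ])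

  ⟦_⟧₀ : Formula [] → Reward
  ⟦ φ ⟧₀ σ = 𝟙 (valuation σ ⊨ φ)

  ∀-box-≢ : ε₀ ⊨ ∀′ tt ∙ [ coin ]⟨ p½ ⟩ x≢l
  ∀-box-≢ v _ = subst (½ ≤_) (sym (𝐄-coin ε₀ r)) (average-≥½ ε₀ r (helper (x-differs v)))
    where
    r = ⟦ x≢l ⟧ v
    helper : ε₀ x ≢ v ⊎ ε₁ x ≢ v → value (r (heads ε₀ r)) ≡ 1# ⊎ value (r (tails ε₀ r)) ≡ 1#
    helper (inj₁ ≢v) = inj₁ (𝟙-true λ t → ≢v (x≐l⇒ {ε₀} t))
    helper (inj₂ ≢v) = inj₂ (𝟙-true λ t → ≢v (x≐l⇒ {ε₁} t))

  ¬box-∀-≢ : ¬ (ε₀ ⊨ [ coin ]⟨ p½ ⟩ (∀′ tt ∙ x≢l))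
  ¬box-∀-≢ h = ½≰0 (subst (½ ≤_)
    (trans (𝐄-coin ε₀ r) (average-00 ε₀ r (𝟙-false (never ε₀)) (𝟙-false (never ε₁)))) h)
    where
    r = ⟦ ∀′ tt ∙ x≢l ⟧₀
    never : ∀ ε → ¬ (ε ⊨ ∀′ tt ∙ x≢l)
    -- The value of x itself is the violating instance.
    never ε ∀≢ = ∀≢ (ε x) tt (⇒x≐l {ε} refl)

  box-∃-≡ : ε₀ ⊨ [ coin ]⟨ p1 ⟩ (∃′ tt ∙ x≐l)
  box-∃-≡ = ≤-reflexive (sym (trans (𝐄-coin ε₀ r)
    (average-11 ε₀ r (𝟙-true (always ε₀)) (𝟙-true (always ε₁)))))
    where
    r = ⟦ ∃′ tt ∙ x≐l ⟧₀
    always : ∀ ε → ε ⊨ ∃′ tt ∙ x≐l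
    always ε ∀≢ = ∀≢ (ε x) tt (⇒x≐l {ε} refl)

  ¬∃-box-≡ : ¬ (ε₀ ⊨ ∃′ tt ∙ [ coin ]⟨ p1 ⟩ x≐l)
  -- Since `∃′` unfolds to a negated universal, refuting the box for each v suffices.
  ¬∃-box-≡ h = h λ v _ b → let r = ⟦ x≐l ⟧ v in
    1≰½ (≤-trans (subst (1# ≤_) (𝐄-coin ε₀ r) b) (average-≤½ ε₀ r (helper (x-differs v))))
    where
    helper : ∀ {v} → ε₀ x ≢ v ⊎ ε₁ x ≢ v → let r = ⟦ x≐l ⟧ v in
             value (r (heads ε₀ r)) ≡ 0# ⊎ value (r (tails ε₀ r)) ≡ 0#
    helper (inj₁ ≢v) = inj₁ (𝟙-false λ t → ≢v (x≐l⇒ {ε₀} t))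
    helper (inj₂ ≢v) = inj₂ (𝟙-false λ t → ≢v (x≐l⇒ {ε₁} t))

theorem6 :
  (em : ExcludedMiddle 0ℓ) (R : CompleteOrderedField) (PV : ProgramVariables) →
  ( (∀ (LV : Values.LogicalVariables R) → let open pDL em R PV LV in
       ∀ (ε : Valuation) (p : LowerBound) (s : Program) (l : L) (φ : Formula (l ∷ [])) →
       AlmostSurelyTerminating s → Admissible φ →
       ε ⊨ [ s ]⟨ p ⟩ (∀′ l ∙ φ) → ε ⊨ ∀′ l ∙ [ s ]⟨ p ⟩ φ)
  × (ProgramVariables.X PV →
       ∃ λ (LV : Values.LogicalVariables R) → let open pDL em R PV LV in
       ∃ λ (ε : Valuation) → ∃ λ (p : LowerBound) → ∃ λ (s : Program) →
       ∃ λ (l : L) → ∃ λ (φ : Formula (l ∷ [])) →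
       AlmostSurelyTerminating s × Admissible φ ×
       (ε ⊨ ∀′ l ∙ [ s ]⟨ p ⟩ φ) × ¬ (ε ⊨ [ s ]⟨ p ⟩ (∀′ l ∙ φ))))
  ×
  ( (∀ (LV : Values.LogicalVariables R) → let open pDL em R PV LV in
       ∀ (ε : Valuation) (p : LowerBound) (s : Program) (l : L) (φ : Formula (l ∷ [])) →
       AlmostSurelyTerminating s → Admissible φ →
       ε ⊨ ∃′ l ∙ [ s ]⟨ p ⟩ φ → ε ⊨ [ s ]⟨ p ⟩ (∃′ l ∙ φ))
  × (ProgramVariables.X PV →
       ∃ λ (LV : Values.LogicalVariables R) → let open pDL em R PV LV in
       ∃ λ (ε : Valuation) → ∃ λ (p : LowerBound) → ∃ λ (s : Program) →
       ∃ λ (l : L) → ∃ λ (φ : Formula (l ∷ [])) →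
       AlmostSurelyTerminating s × Admissible φ ×
       (ε ⊨ [ s ]⟨ p ⟩ (∃′ l ∙ φ)) × ¬ (ε ⊨ ∃′ l ∙ [ s ]⟨ p ⟩ φ)))
theorem6 em R PV =
    ( (λ LV ε p s l φ _ _ → Quantifiers.box-∀ em R PV LV {p = p} {s} {φ = φ})
    , λ x → let open Counterexamples em R PV x
                open Expectations.Coin em R PV x in
        -- Both blanks have the unit type: the logical variable, and admissibility, which is trivial
        -- for a formula without boxes.
        LV , ε₀ , p½ , coin , _ , x≢l , coin-terminates , _ , ∀-box-≢ , ¬box-∀-≢ )
  , ( (λ LV ε p s l φ _ _ → Quantifiers.∃-box em R PV LV {p = p} {s} {φ = φ})
    , λ x → let open Counterexamples em R PV x
                open Expectations.Coin em R PV x in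
        LV , ε₀ , p1 , coin , _ , x≐l , coin-terminates , _ , box-∃-≡ , ¬∃-box-≡ )
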